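{- $\text{HG}(\mathcal{P}lanar) \geq 22$, where $\mathcal{P}lanar$ is the class of all planar graphs.
   Context: Hat guessing game $\langle G, h, g\rangle$: a sage sits at each vertex $v$ of the graph $G$; an adversary puts on the head of each sage $v$ a hat whose color is chosen from $\{0,1,\dots,h(v)-1\}$; each sage sees the hat colors of his neighbours but not his own; without communication, each sage $v$ names a list of $g(v)$ colors, determined by a deterministic strategy (fixed in advance and known to the adversary) from the colors he sees. The game is winning if there is a strategy guaranteeing that for every hat assignment at least one sage's list contains his own hat color. For a graph $G$ and integer $s\ge 1$, $\text{HG}_s(G)$ is the maximal $k$ such that the game $\langle G, h, g\rangle$ with $h$ the function constantly equal to $k$ and $g$ the function constantly equal to $s$ is winning; $\text{HG}(G)=\text{HG}_1(G)$. For a class of graphs $\mathcal{C}$, $\text{HG}_s(\mathcal{C})=\sup\{\text{HG}_s(G): G\in\mathcal{C}\}$. -}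

module Defs where

open import Data.Nat using (ℕ; _≤_)
open import Data.Fin using (Fin)
open import Data.Bool using (Bool; true; false)
open import Data.Product using (Σ; ∃; ∃-syntax; _×_; _,_)
open import Data.Sum using (_⊎_)
open import Relation.Binary.PropositionalEquality using (_≡_)
open import Relation.Nullary using (¬_)
open import Data.Rational as ℚ using (ℚ; 0ℚ; 1ℚ)

record Graph : Set where
  field
    n     : ℕ
    adj   : Fin n → Fin n → Bool
    sym   : ∀ u v → adj u v ≡ adj v u
    irrefl : ∀ v → adj v v ≡ false

open Graph public

Edge : (G : Graph) → Fin (n G) → Fin (n G) → Set
Edge G u v = adj G u v ≡ true

-- Hat guessing game ⟨G, h, g⟩ with h ≡ k and g ≡ 1.
-- A hat assignment is a function Fin n → Fin k.  A strategy assigns to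
-- each sage v a guess computed from the whole assignment, subject to
-- the constraint that it depends only on the hats of v's neighbours.
Assignment : (G : Graph) → ℕ → Set
Assignment G k = Fin (n G) → Fin k

record Strategy (G : Graph) (k : ℕ) : Set where
  field
    guess : Fin (n G) → Assignment G k → Fin k
    local : ∀ v (c c′ : Assignment G k) →
            (∀ u → Edge G v u → c u ≡ c′ u) → guess v c ≡ guess v c′

open Strategy public

Winning : Graph → ℕ → Set
Winning G k = Σ (Strategy G k) λ s →
  ∀ (c : Assignment G k) → ∃[ v ] (guess s v c ≡ c v)

-- HG(G) ≥ m : some k ≥ m for which the game with k colours is winning
-- (HG(G) is the maximum such k).
HG≥ : Graph → ℕ → Set
HG≥ G m = ∃[ k ] (m ≤ k × Winning G k)

-- Planarity, via straight-line drawings with rational coordinates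
-- (Fáry's theorem; rational coordinates can be achieved by perturbation).
Point : Set
Point = ℚ × ℚ

OnSegment : Point → Point → Point → Set
OnSegment (x₁ , x₂) (p₁ , p₂) (q₁ , q₂) =
  ∃[ t ] (0ℚ ℚ.≤ t × t ℚ.≤ 1ℚ ×
          x₁ ≡ p₁ ℚ.+ t ℚ.* (q₁ ℚ.- p₁) ×
          x₂ ≡ p₂ ℚ.+ t ℚ.* (q₂ ℚ.- p₂))

record StraightLineDrawing (G : Graph) : Set where
  field
    pos : Fin (n G) → Point
    pos-injective : ∀ u v → pos u ≡ pos v → u ≡ v
    vertex-off-edge : ∀ v a b → Edge G a b →
      OnSegment (pos v) (pos a) (pos b) → v ≡ a ⊎ v ≡ b
    edges-disjoint : ∀ a b c d → Edge G a b → Edge G c d →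
      ¬ ((a ≡ c × b ≡ d) ⊎ (a ≡ d × b ≡ c)) →
      ∀ x → OnSegment x (pos a) (pos b) → OnSegment x (pos c) (pos d) →
      ∃[ w ] (x ≡ pos w × (w ≡ a ⊎ w ≡ b) × (w ≡ c ⊎ w ≡ d))

Planar : Graph → Set
Planar G = StraightLineDrawing G

{-# OPTIONS --safe #-}
module Submission where

-- The graph is the join of an edge AB with a long path. Cut the path into blocks of 10 vertices,
-- one block for each sequence of six pairs of colours. On a path with 10 vertices the sages win
-- for 22 colours if each may name 6 colours; a block attached to six distinct pairs plays one of
-- the six guesses when A and B wear the corresponding pair. Hence, given the hats on the path, at
-- most five pairs of hats on A and B make the whole path fail. These pairs form a bipartite graph
-- with at most five edges; its components contain at most one cycle each, so every edge can be
-- assigned to one of its ends with no end used twice. This tells A what to guess from B's hat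
-- and B what to guess from A's.

open import Defs
open import Data.Product using (∃-syntax; _×_)
open import Level using (0ℓ)
open import Data.Bool using (Bool; true; false; T; _∨_; if_then_else_)
open import Data.Bool.Properties using (∨-comm; T-≡; T-∨)
open import Data.Empty using (⊥; ⊥-elim)
open import Data.Fin using (Fin; zero; suc; toℕ; fromℕ; fromℕ<; inject₁; combine;
  remQuot; finToFun; funToFin; _≟_)
open import Data.Fin.Properties using (all?; any?; toℕ<n; toℕ-injective; toℕ-inject₁; fromℕ<-toℕ; toℕ-fromℕ<;
  toℕ-combine; remQuot-combine; finToFun-funToFin; ¬∀⟶∃¬)
import Data.Integer as ℤ
import Data.Integer.Properties as ℤ
open import Data.List using (List; []; _∷_; length; lookup; filter; allFin)
open import Data.List.Membership.Propositional using (_∈_)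
open import Data.List.Membership.Propositional.Properties using (∈-lookup; ∈-filter⁺; ∈-allFin)
open import Data.List.Relation.Unary.All as All using (All; []; _∷_)
open import Data.List.Relation.Unary.AllPairs using ([]; _∷_)
open import Data.List.Relation.Unary.Any using (here; there)
open import Data.List.Relation.Unary.Unique.Propositional using (Unique)
open import Data.Nat as ℕ using (ℕ; zero; suc; _+_; _*_; _^_; _∸_; _%_; _≤_; s≤s; _≤?_; _<?_; _<ᵇ_; _≡ᵇ_)
open import Data.Nat.Coprimality as Coprimality using (1-coprimeTo)
open import Data.Nat.Properties as ℕ using (+-suc; ≡⇒≡ᵇ; ≡ᵇ⇒≡)
open import Data.Product using (Σ; _,_; proj₁; proj₂; map; swap; uncurry)
open import Data.Product.Properties using (≡-dec; ,-injectiveʳ)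
open import Data.Rational as ℚ using (ℚ; mkℚ; 0ℚ; 1ℚ; *≤*)
import Data.Rational.Properties as ℚ
open import Data.Rational.Solver using (module +-*-Solver)
open import Data.Sum as Sum using (_⊎_; inj₁; inj₂)
open import Data.Vec as Vec using (Vec; []; _∷_; tabulate)
open import Data.Vec.Properties using (tabulate-cong; lookup∘tabulate)
open import Function using (_∘_; id; flip; Equivalence)
open import Function.Definitions using (Injective)
open import Relation.Binary using (Rel; Decidable; tri<; tri≈; tri>)
open import Relation.Binary.PropositionalEquality using (_≡_; _≢_; _≗_; refl; trans; cong; cong₂; subst; subst₂;
  module ≡-Reasoning) renaming (sym to ≡-sym)
open import Relation.Nullary using (¬_; Dec; yes; no)
open import Relation.Nullary.Decidable using (_×-dec_; ¬?; T?; from-yes; decidable-stable)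
import Relation.Unary as U
open Equivalence using (to; from)
open +-*-Solver using (solve; _:=_; _:+_; _:*_; _:-_; :-_; con)

-- Two players with at most five possible pairs of hats

lookup-injective : ∀ {A : Set} {xs : List A} → Unique xs → Injective _≡_ _≡_ (lookup xs)
lookup-injective (_ ∷ _)  {zero}  {zero}  _  = refl
lookup-injective (x∉ ∷ _) {zero}  {suc j} eq = ⊥-elim (All.lookup x∉ (∈-lookup j) eq)
lookup-injective (x∉ ∷ _) {suc i} {zero}  eq = ⊥-elim (All.lookup x∉ (∈-lookup i) (≡-sym eq))
lookup-injective (_ ∷ u)  {suc i} {suc j} eq = cong suc (lookup-injective u eq)

-- Phrased with injections from `Fin 6` because six distinct pairs in a row are exactly what indexes
-- a block of the path.
AtMostFive : ∀ {k} → Rel (Fin k) 0ℓ → Set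
AtMostFive {k} R = ∀ (e : Fin 6 → Fin k × Fin k) → Injective _≡_ _≡_ e → ¬ (∀ q → uncurry R (e q))

-- Two players who see each other's colour and know that the pair (a , b) lies in R.
Guessable : ∀ {k} → Rel (Fin k) 0ℓ → Set
Guessable {k} R = Σ (Fin k → Fin k) λ α → Σ (Fin k → Fin k) λ β →
  ∀ {a b} → R a b → α b ≡ a ⊎ β a ≡ b

module _ {k : ℕ} {R : Rel (Fin k) 0ℓ} (five : AtMostFive R) where

  -- Every use of the bound five goes through this; `AtMostFive-flip` turns it into the same fact
  -- for columns.
  ¬three-rows : ∀ {a₁ a₂ a₃ b₁ b₂ b₃ c₁ c₂ c₃} → a₁ ≢ a₂ → a₁ ≢ a₃ → a₂ ≢ a₃ →
                b₁ ≢ c₁ → b₂ ≢ c₂ → b₃ ≢ c₃ →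
                R a₁ b₁ → R a₁ c₁ → R a₂ b₂ → R a₂ c₂ → R a₃ b₃ → R a₃ c₃ → ⊥
  ¬three-rows {a₁} {a₂} {a₃} {b₁} {b₂} {b₃} {c₁} {c₂} {c₃} n₁₂ n₁₃ n₂₃ m₁ m₂ m₃ r₁ s₁ r₂ s₂ r₃ s₃ =
    five (lookup es) (lookup-injective unique) (λ q → All.lookup inR (∈-lookup {xs = es} q))
    where
    es : List (Fin k × Fin k)
    es = (a₁ , b₁) ∷ (a₁ , c₁) ∷ (a₂ , b₂) ∷ (a₂ , c₂) ∷ (a₃ , b₃) ∷ (a₃ , c₃) ∷ []
    inR : All (uncurry R) es
    inR = r₁ ∷ s₁ ∷ r₂ ∷ s₂ ∷ r₃ ∷ s₃ ∷ []
    row : ∀ {a a′ b b′ : Fin k} → a ≢ a′ → (a , b) ≢ (a′ , b′)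
    row n = n ∘ cong proj₁
    col : ∀ {a a′ b b′ : Fin k} → b ≢ b′ → (a , b) ≢ (a′ , b′)
    col n = n ∘ cong proj₂
    unique : Unique es
    unique = (col m₁ ∷ row n₁₂ ∷ row n₁₂ ∷ row n₁₃ ∷ row n₁₃ ∷ [])
           ∷ (row n₁₂ ∷ row n₁₂ ∷ row n₁₃ ∷ row n₁₃ ∷ [])
           ∷ (col m₂ ∷ row n₂₃ ∷ row n₂₃ ∷ [])
           ∷ (row n₂₃ ∷ row n₂₃ ∷ [])
           ∷ (col m₃ ∷ [])
           ∷ []
           ∷ []

  AtMostFive-flip : AtMostFive (flip R)
  AtMostFive-flip e inj all = five (swap ∘ e) (inj ∘ cong swap) all

module _ {k : ℕ} {R : Rel (Fin k) 0ℓ} (R? : Decidable R) (five : AtMostFive R) where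

  -- A row of R meeting column b, and if possible another column too. With this preference, two
  -- columns that leave the same row over yield a rectangle in R or six pairs.
  record Choice (b : Fin k) : Set where
    field
      row    : Fin k
      inside : ∀ {a} → R a b → R row b
      shared : ∀ {a c} → R a b → R a c → b ≢ c → ∃[ d ] (b ≢ d × R row d)

  choice : ∀ b → Choice b
  choice b with any? (λ a → R? a b ×-dec any? (λ c → ¬? (b ≟ c) ×-dec R? a c))
  ... | yes (a , r , sh) = record { row = a ; inside = λ _ → r ; shared = λ _ _ _ → sh }
  ... | no none with any? (λ a → R? a b)
  ...   | yes (a , r) = record
    { row = a ; inside = λ _ → r ; shared = λ r s n → ⊥-elim (none (_ , r , _ , n , s)) }
  -- Nothing is demanded of an empty column, so `b` serves as an arbitrary row.
  ...   | no empty    = record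
    { row = b ; inside = λ r → ⊥-elim (empty (_ , r)) ; shared = λ r _ _ → ⊥-elim (empty (_ , r)) }

  open Choice

  γ : Fin k → Fin k
  γ b = row (choice b)

  Leftover : Rel (Fin k) 0ℓ
  Leftover a b = R a b × γ b ≢ a

  leftover? : Decidable Leftover
  leftover? a b = R? a b ×-dec ¬? (γ b ≟ a)

  -- The obstruction to A playing `γ`: all leftover pairs fall to B, who can name only one column on
  -- seeing `a`.
  Conflict : Set
  Conflict = ∃[ a ] ∃[ b ] ∃[ b′ ] (b ≢ b′ × Leftover a b × Leftover a b′)

  conflict? : Dec Conflict
  conflict? = any? λ a → any? λ b → any? λ b′ → ¬? (b ≟ b′) ×-dec leftover? a b ×-dec leftover? a b′

  no-conflict⇒guessable : ¬ Conflict → Guessable R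
  no-conflict⇒guessable none = γ , β , covers
    where
    β : Fin k → Fin k
    β a with any? (leftover? a)
    ... | yes (b , _) = b
    ... | no _        = a
    covers : ∀ {a b} → R a b → γ b ≡ a ⊎ β a ≡ b
    covers {a} {b} r with γ b ≟ a
    ... | yes eq = inj₁ eq
    ... | no neq with any? (leftover? a)
    ...   | no ¬l = ⊥-elim (¬l (b , r , neq))
    ...   | yes (b′ , l) with b′ ≟ b
    ...     | yes eq = inj₂ eq
    ...     | no n   = ⊥-elim (none (a , b′ , b , n , l , r , neq))

  -- The corners form a 4-cycle; going around it gives each corner its own player and hat. At most
  -- one more pair exists: `γ` catches it outside the columns `b` and `d`, and the last two clauses
  -- of `β` catch it inside them.
  rectangle⇒guessable : ∀ {a c b d} → a ≢ c → b ≢ d →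
                        R a b → R c b → R a d → R c d → Guessable R
  rectangle⇒guessable {a} {c} {b} {d} a≢c b≢d ab cb ad cd = α , β , covers
    where
    ¬three-columns = ¬three-rows {R = flip R} (AtMostFive-flip {R = R} five)
    α : Fin k → Fin k
    α v with v ≟ b | v ≟ d
    ... | yes _ | _     = c
    ... | no _  | yes _ = a
    ... | no _  | no _  = γ v
    β : Fin k → Fin k
    β u with u ≟ a | u ≟ c | R? u b
    ... | yes _ | _     | _     = b
    ... | no _  | yes _ | _     = d
    ... | no _  | no _  | yes _ = b
    ... | no _  | no _  | no _  = d
    covers : ∀ {u v} → R u v → α v ≡ u ⊎ β u ≡ v
    covers {u} {v} r with v ≟ b | v ≟ d
    ... | no v≢b | no v≢d with γ v ≟ u
    ...   | yes eq = inj₁ eq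
    ...   | no neq = ⊥-elim (¬three-columns b≢d (v≢b ∘ ≡-sym) (v≢d ∘ ≡-sym) a≢c a≢c neq
                               ab cb ad cd (inside (choice v) r) r)
    covers {u} r | yes refl | _ with u ≟ a | u ≟ c | R? u b
    ...   | yes _ | _        | _     = inj₂ refl
    ...   | no _  | yes refl | _     = inj₁ refl
    ...   | no _  | no _     | yes _ = inj₂ refl
    ...   | no _  | no _     | no ¬r = ⊥-elim (¬r r)
    covers {u} r | no _ | yes refl with u ≟ a | u ≟ c | R? u b
    ...   | yes refl | _     | _      = inj₁ refl
    ...   | no _     | yes _ | _      = inj₂ refl
    ...   | no u≢a   | no u≢c | yes r′ = ⊥-elim (¬three-rows five a≢c (u≢a ∘ ≡-sym) (u≢c ∘ ≡-sym) b≢d b≢d b≢d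
                                                    ab ad cb cd r′ r)
    ...   | no _     | no _  | no _   = inj₂ refl

  guessable : Guessable R
  guessable with conflict?
  ... | no none = no-conflict⇒guessable none
  ... | yes (a , b , d , b≢d , (ab , c≢a) , (ad , c′≢a)) with γ b ≟ γ d
  ...   | yes eq = rectangle⇒guessable (c≢a ∘ ≡-sym) b≢d ab (inside (choice b) ab) ad
                     (subst (λ c → R c d) (≡-sym eq) (inside (choice d) ad))
  ...   | no neq =
    -- Row `a` meets both columns, so `shared` supplies a second entry in each of the rows `γ b` and
    -- `γ d`; with row `a` this makes six pairs.
    let _ , b≢b₂ , r₂ = shared (choice b) ab ad b≢d
        _ , d≢d₃ , r₃ = shared (choice d) ad ab (b≢d ∘ ≡-sym)
    in ⊥-elim (¬three-rows five (c≢a ∘ ≡-sym) (c′≢a ∘ ≡-sym) neq b≢d b≢b₂ d≢d₃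
         ab ad (inside (choice b) ab) r₂ (inside (choice d) ad) r₃)

-- Six guesses on a path

-- An s-guess strategy on the path with L vertices. The hats are y 1, …, y L; the strategy must
-- win whatever the colours y 0 and y (1 + L) shown to the end vertices are.
record PathStrategy (k s L : ℕ) : Set where
  field
    guesses : Fin L → Fin k → Fin k → Fin s → Fin k
    wins    : ∀ (y : ℕ → Fin k) →
              ∃[ i ] ∃[ q ] guesses i (y (toℕ i)) (y (2 + toℕ i)) q ≡ y (suc (toℕ i))

nth : ∀ {A : Set} {s} → A → List A → Fin s → A
nth d []       _       = d
nth d (x ∷ xs) zero    = x
nth d (x ∷ xs) (suc q) = nth d xs q

nth-∈ : ∀ {A : Set} {s x} d {xs : List A} → length xs ≤ s → x ∈ xs → ∃[ q ] nth {s = s} d xs q ≡ x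
nth-∈ d (s≤s _)  (here refl) = zero , refl
nth-∈ d (s≤s le) (there x∈)  = map suc id (nth-∈ d le x∈)

first-change : ∀ {n} {P : U.Pred (Fin (suc n)) 0ℓ} → U.Decidable P → ¬ P zero → P (fromℕ n) →
               ∃[ i ] (¬ P (inject₁ i) × P (suc i))
first-change {zero}  P? ¬p p = ⊥-elim (¬p p)
first-change {suc n} P? ¬p p with P? (suc zero)
... | yes p₁ = zero , ¬p , p₁
... | no ¬p₁ = map suc id (first-change (λ i → P? (suc i)) ¬p₁ p)

module _ {k L : ℕ} {Dead : Fin (suc L) → Fin k → Fin k → Set} (dead? : ∀ i z y → Dec (Dead i z y)) where

  candidate? : ∀ (i : Fin L) x z → U.Decidable (λ y → Dead (suc i) z y × ¬ Dead (inject₁ i) y x)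
  candidate? i x z y = dead? (suc i) z y ×-dec ¬? (dead? (inject₁ i) y x)

  candidates : Fin L → Fin k → Fin k → List (Fin k)
  candidates i x z = filter (candidate? i x z) (allFin k)

  -- Dead i z y reads: if the i-th hat is y and the next one is z, then one of the first i sages
  -- is right. The (i + 1)-st sage only has to name the colours that are dead for the next hat
  -- but not killed by the previous one.
  path-strategy : ∀ {s} → (∀ z y → ¬ Dead zero z y) → (∀ z y → Dead (fromℕ L) z y) →
                  (∀ i x z → length (candidates i x z) ≤ s) → PathStrategy k s L
  path-strategy none all few = record
    { guesses = λ i x z → nth x (candidates i x z)
    ; wins    = λ y →
        -- Nothing is dead at index 0 and everything is at index `L`. The first hat to be dead is a
        -- candidate of its own sage.
        let i , alive , dies = first-change (λ i → dead? i (y (suc (toℕ i))) (y (toℕ i)))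
                                 (none _ _) (all _ _)
        in i , nth-∈ _ (few i _ _)
             (∈-filter⁺ (candidate? i (y (toℕ i)) (y (2 + toℕ i))) (∈-allFin _)
               (dies , subst (λ n → ¬ Dead (inject₁ i) (y (suc n)) (y n)) (toℕ-inject₁ i) alive))
    }

-- Chosen greedily from 0: after an entry `d′` comes the largest `d` with `(22 - d′) * d ≤ 6 * 22`.
-- All 22 colours are reached after ten steps, whence the block length.
size : Vec ℕ 11
size = 0 ∷ 6 ∷ 8 ∷ 9 ∷ 10 ∷ 11 ∷ 12 ∷ 13 ∷ 14 ∷ 16 ∷ 22 ∷ []

-- Translates in ℤ/22 of an interval (i even) or of a balanced set (i odd) of the given size d.
-- The i-th sage has at most 6 candidates because (22 - dᵢ₋₁) · dᵢ ≤ 6 · 22, and because a cyclic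
-- interval of length c meets a balanced set of size d in at most ⌈c d / 22⌉ points.
dead : Fin 11 → Fin 22 → Fin 22 → Bool
dead i z y = let d = Vec.lookup size i
                 t = (toℕ y + (22 ∸ toℕ z)) % 22
             -- For `d > 0`, `t * d % 22 < d` holds exactly when a multiple of 22 is reached in
             -- passing from `(t - 1) * d` to `t * d`, so such `t` are evenly spread.
             in if toℕ i % 2 ≡ᵇ 0 then t <ᵇ d else t * d % 22 <ᵇ d

Dead : Fin 11 → Fin 22 → Fin 22 → Set
Dead i z y = T (dead i z y)

dead? : ∀ i z y → Dec (Dead i z y)
dead? i z y = T? (dead i z y)

path₁₀ : PathStrategy 22 6 10
path₁₀ = path-strategy dead?
  (from-yes (all? λ z → all? λ y → ¬? (dead? zero z y)))
  (from-yes (all? λ z → all? λ y → dead? (fromℕ 10) z y))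
  (from-yes (all? λ i → all? λ x → all? λ z → length (candidates dead? i x z) ≤? 6))

-- The game on the join of an edge and a path

consecutive : ∀ {N} → Fin N → Fin N → Bool
consecutive p q = (suc (toℕ p) ≡ᵇ toℕ q) ∨ (suc (toℕ q) ≡ᵇ toℕ p)

consecutive-irrefl : ∀ {N} (p : Fin N) → consecutive p p ≡ false
consecutive-irrefl zero    = refl
consecutive-irrefl (suc p) = consecutive-irrefl p

K₂∨P-adj : ∀ {N} → Fin (2 + N) → Fin (2 + N) → Bool
K₂∨P-adj zero          zero          = false
K₂∨P-adj zero          (suc _)       = true
K₂∨P-adj (suc _)       zero          = true
K₂∨P-adj (suc zero)    (suc zero)    = false
K₂∨P-adj (suc zero)    (suc (suc _)) = true
K₂∨P-adj (suc (suc _)) (suc zero)    = true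
K₂∨P-adj (suc (suc p)) (suc (suc q)) = consecutive p q

K₂∨P : ℕ → Graph
K₂∨P N = record { n = 2 + N ; adj = K₂∨P-adj ; sym = sym-adj ; irrefl = irr }
  where
  sym-adj : ∀ (u v : Fin (2 + N)) → K₂∨P-adj u v ≡ K₂∨P-adj v u
  sym-adj zero          zero          = refl
  sym-adj zero          (suc _)       = refl
  sym-adj (suc _)       zero          = refl
  sym-adj (suc zero)    (suc zero)    = refl
  sym-adj (suc zero)    (suc (suc _)) = refl
  sym-adj (suc (suc _)) (suc zero)    = refl
  sym-adj (suc (suc p)) (suc (suc q)) = ∨-comm (suc (toℕ p) ≡ᵇ toℕ q) _
  irr : ∀ (v : Fin (2 + N)) → K₂∨P-adj v v ≡ false
  irr zero          = refl
  irr (suc zero)    = refl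
  irr (suc (suc p)) = consecutive-irrefl p

edge-next : ∀ {N} (p q : Fin N) → suc (toℕ p) ≡ toℕ q → Edge (K₂∨P N) (suc (suc p)) (suc (suc q))
edge-next p q eq = to T-≡ (from T-∨ (inj₁ (≡⇒≡ᵇ _ _ eq)))

edge-prev : ∀ {N} (p q : Fin N) → suc (toℕ q) ≡ toℕ p → Edge (K₂∨P N) (suc (suc p)) (suc (suc q))
edge-prev p q eq = to T-≡ (from (T-∨ {suc (toℕ p) ≡ᵇ toℕ q}) (inj₂ (≡⇒≡ᵇ _ _ eq)))

module _ {k : ℕ} (d : Fin k) where

  -- pad x (suc t) is the t-th hat; positions outside the path get the colour d.
  pad : ∀ {N} → (Fin N → Fin k) → ℕ → Fin k
  pad x zero = d
  pad {N} x (suc t) with t <? N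
  ... | yes t<N = x (fromℕ< t<N)
  ... | no _    = d

  pad-suc-toℕ : ∀ {N} (x : Fin N → Fin k) p → pad x (suc (toℕ p)) ≡ x p
  pad-suc-toℕ {N} x p with toℕ p <? N
  ... | yes lt = cong x (fromℕ<-toℕ p lt)
  ... | no ≮N  = ⊥-elim (≮N (toℕ<n p))

  pad-cong : ∀ {N} {x x′ : Fin N → Fin k} t → (∀ p → suc (toℕ p) ≡ t → x p ≡ x′ p) → pad x t ≡ pad x′ t
  pad-cong zero h = refl
  pad-cong {N} (suc t) h with t <? N
  ... | yes lt = h _ (cong suc (toℕ-fromℕ< lt))
  ... | no _   = refl

module Copies {k s L : ℕ} (d : Fin k) (S : PathStrategy k s L) where
  open PathStrategy S

  -- One copy of the path for each sequence of s pairs of hats on the two apexes.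
  copies : ℕ
  copies = (k * k) ^ s

  N : ℕ
  N = copies * L

  pairs : Fin copies → Fin s → Fin k × Fin k
  pairs j = remQuot k ∘ finToFun j

  -- If the apexes wear the q-th pair of its sequence, then the copy plays its q-th guesses.
  copy-guess : Fin copies × Fin L → Fin k × Fin k → Fin k → Fin k → Fin k
  copy-guess (j , i) ab l r with any? (λ q → ≡-dec _≟_ _≟_ (pairs j q) ab)
  ... | yes (q , _) = guesses i l r q
  -- The pair is not in this block's sequence; any colour would do.
  ... | no _        = l

  -- The search may return another index than `q`; injectivity identifies the two.
  copy-guess-pair : ∀ j i (l r : Fin k) {q ab} → Injective _≡_ _≡_ (pairs j) → pairs j q ≡ ab →
                    copy-guess (j , i) ab l r ≡ guesses i l r q
  copy-guess-pair j i l r {q} {ab} inj eq with any? (λ q → ≡-dec _≟_ _≟_ (pairs j q) ab)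
  ... | yes (q′ , eq′) = cong (guesses i l r) (inj (trans eq′ (≡-sym eq)))
  ... | no ¬q          = ⊥-elim (¬q (q , eq))

  encode : (Fin s → Fin k × Fin k) → Fin copies
  encode e = funToFin (uncurry combine ∘ e)

  pairs-encode : ∀ e q → pairs (encode e) q ≡ e q
  pairs-encode e q = trans (cong (remQuot k) (finToFun-funToFin (uncurry combine ∘ e) q))
                           (uncurry remQuot-combine (e q))

  -- At the ends of a block, the missing neighbour is replaced by a hat of the adjacent block or by
  -- padding; a `PathStrategy` wins for any such colours.
  path-sage : Fin N → Fin k → Fin k → (Fin N → Fin k) → Fin k
  path-sage p a b x = copy-guess (remQuot L p) (a , b) (pad d x (toℕ p)) (pad d x (2 + toℕ p))

  path-sage-cong : ∀ p a b {x x′ : Fin N → Fin k} → x ≗ x′ → path-sage p a b x ≡ path-sage p a b x′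
  path-sage-cong p a b x≗ = cong₂ (copy-guess (remQuot L p) (a , b))
    (pad-cong d (toℕ p) λ q _ → x≗ q) (pad-cong d (2 + toℕ p) λ q _ → x≗ q)

  AllWrong : (Fin N → Fin k) → Fin k → Fin k → Set
  AllWrong x a b = ∀ p → path-sage p a b x ≢ x p

  allWrong? : ∀ x a b → Dec (AllWrong x a b)
  allWrong? x a b = all? λ p → ¬? (path-sage p a b x ≟ x p)

  -- In the block encoding `e`, some sage's `q`-th guess is right, and that guess is played when the
  -- apexes wear `e q`. For `s = 6` this is `AtMostFive (AllWrong x)`.
  ¬all-wrong : ∀ x (e : Fin s → Fin k × Fin k) → Injective _≡_ _≡_ e → ¬ (∀ q → uncurry (AllWrong x) (e q))
  ¬all-wrong x e inj wrong =
    let j           = encode e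
        start       = L * toℕ j
        i , q , eq  = wins (λ t → pad d x (start + t))
        p           = combine j i
        p≡          = toℕ-combine j i
        1+p≡        = trans (+-suc start (toℕ i)) (cong suc (≡-sym p≡))
        2+p≡        = trans (+-suc start (suc (toℕ i))) (cong suc 1+p≡)
        l           = pad d x (toℕ p)
        r           = pad d x (2 + toℕ p)
        pairs-inj   = λ {q} {q′} eq → inj (trans (≡-sym (pairs-encode e q)) (trans eq (pairs-encode e q′)))
    in wrong q p (begin
      copy-guess (remQuot L p) (e q) l r
        ≡⟨ cong (λ ji → copy-guess ji (e q) l r) (remQuot-combine j i) ⟩
      copy-guess (j , i) (e q) l r
        ≡⟨ copy-guess-pair j i l r pairs-inj (pairs-encode e q) ⟩
      guesses i l r q
        ≡⟨ cong₂ (λ m n → guesses i (pad d x m) (pad d x n) q) p≡ (≡-sym 2+p≡) ⟩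
      guesses i (pad d x (start + toℕ i)) (pad d x (start + (2 + toℕ i))) q
        ≡⟨ eq ⟩
      pad d x (start + suc (toℕ i))
        ≡⟨ cong (pad d x) 1+p≡ ⟩
      pad d x (suc (toℕ p))
        ≡⟨ pad-suc-toℕ d x p ⟩
      x p ∎)
    where open ≡-Reasoning

  -- Strategy for the whole graph

  module _ (apexes : ∀ x → Guessable (AllWrong x)) where

    G = K₂∨P N

    -- As a vector, so that hat assignments agreeing pointwise give equal apex strategies.
    path-hats : Assignment G k → Vec (Fin k) N
    path-hats c = tabulate (λ p → c (suc (suc p)))

    play : Fin (2 + N) → Assignment G k → Fin k
    play zero          c = proj₁ (apexes (Vec.lookup (path-hats c))) (c (suc zero))
    play (suc zero)    c = proj₁ (proj₂ (apexes (Vec.lookup (path-hats c)))) (c zero)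
    play (suc (suc p)) c = path-sage p (c zero) (c (suc zero)) (λ p → c (suc (suc p)))

    play-local : ∀ v (c c′ : Assignment G k) → (∀ u → Edge G v u → c u ≡ c′ u) → play v c ≡ play v c′
    play-local zero c c′ h =
      cong₂ (λ xs → proj₁ (apexes (Vec.lookup xs))) (tabulate-cong (λ p → h (suc (suc p)) refl)) (h (suc zero) refl)
    play-local (suc zero) c c′ h =
      cong₂ (λ xs → proj₁ (proj₂ (apexes (Vec.lookup xs)))) (tabulate-cong (λ p → h (suc (suc p)) refl)) (h zero refl)
    play-local (suc (suc p)) c c′ h
      rewrite h zero refl | h (suc zero) refl
      = cong₂ (copy-guess (remQuot L p) (c′ zero , c′ (suc zero)))
          (pad-cong d (toℕ p) (λ q eq → h _ (edge-prev p q eq)))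
          (pad-cong d (2 + toℕ p) (λ q eq → h _ (edge-next p q (≡-sym (cong ℕ.pred eq)))))

    play-wins : ∀ (c : Assignment G k) → ∃[ v ] play v c ≡ c v
    play-wins c with allWrong? (Vec.lookup (path-hats c)) (c zero) (c (suc zero))
    ... | yes wrong with proj₂ (proj₂ (apexes _)) wrong
    ...   | inj₁ eq = zero , eq
    ...   | inj₂ eq = suc zero , eq
    play-wins c | no ¬wrong =
      let x      = Vec.lookup (path-hats c)
          a      = c zero
          b      = c (suc zero)
          x≗     = λ q → lookup∘tabulate (λ p → c (suc (suc p))) q
          p , ¬≢ = ¬∀⟶∃¬ N _ (λ p → ¬? (path-sage p a b x ≟ x p)) ¬wrong
          eq     = decidable-stable (path-sage p a b x ≟ x p) ¬≢
      in suc (suc p) , trans (≡-sym (path-sage-cong p a b x≗)) (trans eq (x≗ p))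

    winning : Winning G k
    winning = record { guess = play ; local = play-local } , play-wins

K₂∨P-winning : ∀ {k L} → Fin k → PathStrategy k 6 L → ∃[ N ] Winning (K₂∨P N) k
K₂∨P-winning d S = _ , winning λ x → guessable (allWrong? x) (¬all-wrong x)
  where open Copies d S

-- Drawing with the path on a vertical line and the apexes at (-1 , 0) and (1 , 0)

-- The value `m + 1`, which keeps the path off the base edge. Explicit lowest terms let equal
-- heights be matched by `refl`.
height : ℕ → ℚ
height m = mkℚ (ℤ.+ suc m) 0 (Coprimality.sym (1-coprimeTo (suc m)))

height-mono : ∀ {m n} → m ℕ.≤ n → height m ℚ.≤ height n
height-mono m≤n = *≤* (ℤ.*-monoʳ-≤-nonNeg (ℤ.+ 1) (ℤ.+≤+ (ℕ.s≤s m≤n)))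

height-cancel-≤ : ∀ {m n} → height m ℚ.≤ height n → m ℕ.≤ n
height-cancel-≤ {m} {n} le = ℕ.s≤s⁻¹ (ℤ.drop‿+≤+ (ℤ.*-cancelʳ-≤-pos (ℤ.+ suc m) (ℤ.+ suc n) (ℤ.+ 1) (ℚ.drop-*≤* le)))

height-injective : ∀ {m n} → height m ≡ height n → m ≡ n
height-injective refl = refl

height≢0 : ∀ {m} → height m ≢ 0ℚ
height≢0 ()

height≰0 : ∀ {m} → ¬ height m ℚ.≤ 0ℚ
height≰0 (*≤* (ℤ.+≤+ ()))

*-cancelˡ-≢0 : ∀ r {p q} → r ≢ 0ℚ → r ℚ.* p ≡ r ℚ.* q → p ≡ q
*-cancelˡ-≢0 r {p} {q} r≢0 eq = begin
  p                   ≡⟨ unit p ⟩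
  ℚ.1/ r ℚ.* (r ℚ.* p) ≡⟨ cong (ℚ.1/ r ℚ.*_) eq ⟩
  ℚ.1/ r ℚ.* (r ℚ.* q) ≡⟨ unit q ⟨
  q                   ∎
  where
  open ≡-Reasoning
  instance _ = ℚ.≢-nonZero r≢0
  unit : ∀ p → p ≡ ℚ.1/ r ℚ.* (r ℚ.* p)
  unit p = trans (≡-sym (ℚ.*-identityˡ p)) (trans (cong (ℚ._* p) (≡-sym (ℚ.*-inverseˡ r))) (ℚ.*-assoc (ℚ.1/ r) r p))

data Side : Set where
  left right : Side

-- Reflects the half-plane of the given side onto the left one.
side : Side → ℚ → ℚ
side left  x = x
side right x = ℚ.- x

side-involutive : ∀ s x → side s (side s x) ≡ x
side-involutive left  x = refl
side-involutive right x = solve 1 (λ x → :- (:- x) := x) refl x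

module _ {N : ℕ} where

  private
    V = Fin (2 + N)
    G = K₂∨P N

  onPath : Fin N → V
  onPath p = suc (suc p)

  apex : Side → V
  apex left  = zero
  apex right = suc zero

  pos : V → Point
  pos zero          = ℚ.- 1ℚ , 0ℚ
  pos (suc zero)    = 1ℚ , 0ℚ
  pos (suc (suc p)) = 0ℚ , height (toℕ p)

  pos-apex : ∀ s → pos (apex s) ≡ (side s (ℚ.- 1ℚ) , 0ℚ)
  pos-apex left  = refl
  pos-apex right = refl

  -- One direction per edge keeps the case analysis to three kinds; `orient` and `OnSegment-sym`
  -- reduce all edges to these.
  data Oriented : V → V → Set where
    base  : Oriented zero (suc zero)
    spoke : ∀ s p → Oriented (apex s) (suc (suc p))
    step  : ∀ {p q} → suc (toℕ p) ≡ toℕ q → Oriented (suc (suc p)) (suc (suc q))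

  orient : ∀ u v → Edge G u v → Oriented u v ⊎ Oriented v u
  orient zero          (suc zero)    _ = inj₁ base
  orient zero          (suc (suc p)) _ = inj₁ (spoke left p)
  orient (suc zero)    zero          _ = inj₂ base
  orient (suc zero)    (suc (suc p)) _ = inj₁ (spoke right p)
  orient (suc (suc p)) zero          _ = inj₂ (spoke left p)
  orient (suc (suc p)) (suc zero)    _ = inj₂ (spoke right p)
  orient (suc (suc p)) (suc (suc q)) e =
    Sum.map (step ∘ ≡ᵇ⇒≡ _ _) (step ∘ ≡ᵇ⇒≡ _ _) (to (T-∨ {suc (toℕ p) ≡ᵇ toℕ q}) (from T-≡ e))

  -- A superset of each edge that is described without parameters.
  Region : ∀ {u v} → Oriented u v → Point → Set
  Region base                 (x , y) = y ≡ 0ℚ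
  -- The half-line from the path vertex through the apex and beyond.
  Region (spoke s p)          (x , y) = side s x ℚ.≤ 0ℚ × y ≡ (1ℚ ℚ.+ side s x) ℚ.* height (toℕ p)
  Region (step {p} {q} _)     (x , y) = x ≡ 0ℚ × height (toℕ p) ℚ.≤ y × y ℚ.≤ height (toℕ q)

  spoke-region : ∀ {s t x y h} → t ℚ.≤ 1ℚ → side s x ≡ ℚ.- 1ℚ ℚ.+ t → y ≡ 0ℚ ℚ.+ t ℚ.* (h ℚ.- 0ℚ) →
                 side s x ℚ.≤ 0ℚ × y ≡ (1ℚ ℚ.+ side s x) ℚ.* h
  spoke-region {s} {t} {x} {y} {h} t≤1 x≡ y≡ rewrite x≡ =
      ℚ.+-monoʳ-≤ (ℚ.- 1ℚ) t≤1
    , trans y≡ (solve 2 (λ t h → con 0ℚ :+ t :* (h :- con 0ℚ) := (con 1ℚ :+ (con (ℚ.- 1ℚ) :+ t)) :* h) refl t h)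

  segment⊆region : ∀ {u v} (e : Oriented u v) x → OnSegment x (pos u) (pos v) → Region e x
  segment⊆region base x (t , _ , _ , _ , y≡) = trans y≡ (solve 1 (λ t → con 0ℚ :+ t :* con 0ℚ := con 0ℚ) refl t)
  segment⊆region (spoke left p) x (t , _ , t≤1 , x≡ , y≡) =
    spoke-region {left} t≤1 (trans x≡ (solve 1 (λ t → con (ℚ.- 1ℚ) :+ t :* con 1ℚ := con (ℚ.- 1ℚ) :+ t) refl t)) y≡
  segment⊆region (spoke right p) x (t , _ , t≤1 , x≡ , y≡) =
    spoke-region {right} t≤1 (trans (cong ℚ.-_ x≡)
      (solve 1 (λ t → :- (con 1ℚ :+ t :* con (ℚ.- 1ℚ)) := con (ℚ.- 1ℚ) :+ t) refl t)) y≡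
  segment⊆region (step {p} {q} next) x (t , 0≤t , t≤1 , x≡ , y≡) =
      trans x≡ (solve 1 (λ t → con 0ℚ :+ t :* con 0ℚ := con 0ℚ) refl t)
    , subst₂ ℚ._≤_ (solve 2 (λ a d → a :+ con 0ℚ :* d := a) refl a d) (≡-sym y≡)
        (ℚ.+-monoʳ-≤ a (ℚ.*-monoʳ-≤-nonNeg d 0≤t))
    , subst₂ ℚ._≤_ (≡-sym y≡) (solve 2 (λ a b → a :+ con 1ℚ :* (b :- a) := b) refl a b)
        (ℚ.+-monoʳ-≤ a (ℚ.*-monoʳ-≤-nonNeg d t≤1))
    where
    a = height (toℕ p)
    b = height (toℕ q)
    d = b ℚ.- a
    instance
      d≥0 : ℚ.NonNegative d
      d≥0 = ℚ.nonNegative (subst (ℚ._≤ d) (ℚ.+-inverseʳ a)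
        (ℚ.+-monoˡ-≤ (ℚ.- a) (height-mono (ℕ.≤-trans (ℕ.n≤1+n _) (ℕ.≤-reflexive next)))))

  OnSegment-sym : ∀ {x} u v → OnSegment x u v → OnSegment x v u
  OnSegment-sym (u₁ , u₂) (v₁ , v₂) (t , 0≤t , t≤1 , eq₁ , eq₂) =
      1ℚ ℚ.- t
    , ℚ.+-monoʳ-≤ 1ℚ (ℚ.neg-antimono-≤ t≤1)
    , ℚ.+-monoʳ-≤ 1ℚ (ℚ.neg-antimono-≤ 0≤t)
    , trans eq₁ (flip-eq u₁ v₁)
    , trans eq₂ (flip-eq u₂ v₂)
    where
    flip-eq : ∀ a b → a ℚ.+ t ℚ.* (b ℚ.- a) ≡ b ℚ.+ (1ℚ ℚ.- t) ℚ.* (a ℚ.- b)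
    flip-eq a b = solve 3 (λ t a b → a :+ t :* (b :- a) := b :+ (con 1ℚ :- t) :* (a :- b)) refl t a b

  pos-injective : ∀ u v → pos u ≡ pos v → u ≡ v
  pos-injective zero          zero          _  = refl
  pos-injective (suc zero)    (suc zero)    _  = refl
  pos-injective (suc (suc p)) (suc (suc q)) eq = cong onPath (toℕ-injective (height-injective (,-injectiveʳ eq)))
  pos-injective zero          (suc zero)    ()
  pos-injective zero          (suc (suc _)) ()
  pos-injective (suc zero)    zero          ()
  pos-injective (suc zero)    (suc (suc _)) ()
  pos-injective (suc (suc _)) zero          ()
  pos-injective (suc (suc _)) (suc zero)    ()


  side-zero : ∀ s → side s 0ℚ ≡ 0ℚ
  side-zero left  = refl
  side-zero right = refl

  spoke-at-apex : ∀ s {x y h} → 1ℚ ℚ.+ side s x ≡ 0ℚ → y ≡ (1ℚ ℚ.+ side s x) ℚ.* h → (x , y) ≡ pos (apex s)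
  spoke-at-apex s {x} {y} {h} 1+x≡0 y≡ = trans (cong₂ _,_ x≡ y≡0) (≡-sym (pos-apex s))
    where
    open ≡-Reasoning
    y≡0 : y ≡ 0ℚ
    y≡0 = trans y≡ (trans (cong (ℚ._* h) 1+x≡0) (ℚ.*-zeroˡ h))
    x≡ : x ≡ side s (ℚ.- 1ℚ)
    x≡ = begin
      x                                      ≡⟨ side-involutive s x ⟨
      side s (side s x)
        ≡⟨ cong (side s) (solve 1 (λ x → x := con (ℚ.- 1ℚ) :+ (con 1ℚ :+ x)) refl (side s x)) ⟩
      side s (ℚ.- 1ℚ ℚ.+ (1ℚ ℚ.+ side s x))  ≡⟨ cong (λ r → side s (ℚ.- 1ℚ ℚ.+ r)) 1+x≡0 ⟩
      side s (ℚ.- 1ℚ)                        ∎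

  spoke-at-path : ∀ s {x y h} → x ≡ 0ℚ → y ≡ (1ℚ ℚ.+ side s x) ℚ.* h → y ≡ h
  spoke-at-path s {h = h} refl y≡ = trans y≡ (trans (cong (λ r → (1ℚ ℚ.+ r) ℚ.* h) (side-zero s)) (ℚ.*-identityˡ h))

  height-between : ∀ {p q r : Fin N} → suc (toℕ p) ≡ toℕ q →
                   height (toℕ p) ℚ.≤ height (toℕ r) → height (toℕ r) ℚ.≤ height (toℕ q) → r ≡ p ⊎ r ≡ q
  height-between {p} {q} {r} next p≤r r≤q with ℕ.m≤n⇒m<n∨m≡n (height-cancel-≤ p≤r)
  ... | inj₁ p<r = inj₂ (toℕ-injective (ℕ.≤-antisym (height-cancel-≤ r≤q) (subst (ℕ._≤ toℕ r) next p<r)))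
  ... | inj₂ p≡r = inj₁ (toℕ-injective (≡-sym p≡r))

  vertex-in-region : ∀ {a b} (e : Oriented a b) v → Region e (pos v) → v ≡ a ⊎ v ≡ b
  vertex-in-region base zero          _  = inj₁ refl
  vertex-in-region base (suc zero)    _  = inj₂ refl
  vertex-in-region base (suc (suc p)) ()
  vertex-in-region (spoke left  p) zero       _ = inj₁ refl
  vertex-in-region (spoke right p) (suc zero) _ = inj₁ refl
  vertex-in-region (spoke left  p) (suc zero) (*≤* (ℤ.+≤+ ()) , _)
  vertex-in-region (spoke right p) zero       (*≤* (ℤ.+≤+ ()) , _)
  vertex-in-region (spoke s p) (suc (suc q)) (_ , y≡) =
    inj₂ (cong onPath (toℕ-injective (height-injective (spoke-at-path s refl y≡))))
  vertex-in-region (step _)    zero       (() , _)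
  vertex-in-region (step _)    (suc zero) (() , _)
  vertex-in-region (step next) (suc (suc r)) (_ , p≤r , r≤q) =
    Sum.map (cong onPath) (cong onPath) (height-between next p≤r r≤q)

  -- Intersections of two edges

  Same : V → V → V → V → Set
  Same a b c d = (a ≡ c × b ≡ d) ⊎ (a ≡ d × b ≡ c)

  CommonEnd : V → V → V → V → Point → Set
  CommonEnd a b c d x = ∃[ w ] (x ≡ pos w × (w ≡ a ⊎ w ≡ b) × (w ≡ c ⊎ w ≡ d))

  swap-edges : ∀ {a b c d x} → CommonEnd a b c d x → CommonEnd c d a b x
  swap-edges (w , eq , ab , cd) = w , eq , cd , ab

  -- Heights are nonzero, so `y ≡ 0ℚ` forces `1ℚ + side s x` to vanish, which happens only at the
  -- apex.
  base-spoke : ∀ s p x → Region base x → Region (spoke s p) x → CommonEnd zero (suc zero) (apex s) (suc (suc p)) x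
  base-spoke s p (x , y) y≡0 (_ , y≡) with 1ℚ ℚ.+ side s x ℚ.≟ 0ℚ
  ... | no ≢0     = ⊥-elim (height≢0 (*-cancelˡ-≢0 (1ℚ ℚ.+ side s x) ≢0
                      (trans (≡-sym y≡) (trans y≡0 (≡-sym (ℚ.*-zeroʳ (1ℚ ℚ.+ side s x)))))))
  ... | yes 1+x≡0 = apex s , spoke-at-apex s 1+x≡0 y≡ , base-end s , inj₁ refl
    where
    base-end : ∀ s → apex s ≡ zero ⊎ apex s ≡ suc zero
    base-end left  = inj₁ refl
    base-end right = inj₂ refl

  -- Away from the apex the factor `1ℚ + side s x` cancels and the two heights would agree.
  spoke-spoke : ∀ s p q x → p ≢ q → Region (spoke s p) x → Region (spoke s q) x →
                CommonEnd (apex s) (suc (suc p)) (apex s) (suc (suc q)) x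
  spoke-spoke s p q (x , y) p≢q (_ , y≡) (_ , y≡′) with 1ℚ ℚ.+ side s x ℚ.≟ 0ℚ
  ... | no ≢0     = ⊥-elim (p≢q (toℕ-injective (height-injective (*-cancelˡ-≢0 _ ≢0 (trans (≡-sym y≡) y≡′)))))
  ... | yes 1+x≡0 = apex s , spoke-at-apex s 1+x≡0 y≡ , inj₁ refl , inj₁ refl

  -- The two half-planes share only the line `x ≡ 0ℚ`, where each spoke is at its path vertex.
  left-right : ∀ p q x → Region (spoke left p) x → Region (spoke right q) x →
               CommonEnd zero (suc (suc p)) (suc zero) (suc (suc q)) x
  left-right p q (x , y) (x≤0 , y≡) (-x≤0 , y≡′) =
    suc (suc p) , cong₂ _,_ x≡0 y≡p , inj₂ refl ,
    inj₂ (cong onPath (toℕ-injective (height-injective (trans (≡-sym y≡p) y≡q))))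
    where
    x≡0 : x ≡ 0ℚ
    x≡0 = ℚ.≤-antisym x≤0 (subst (0ℚ ℚ.≤_) (side-involutive right x) (ℚ.neg-antimono-≤ -x≤0))
    y≡p = spoke-at-path left x≡0 y≡
    y≡q = spoke-at-path right x≡0 y≡′

  spoke-step : ∀ s p {q r} (next : suc (toℕ q) ≡ toℕ r) x → Region (spoke s p) x → Region (step {q} {r} next) x →
               CommonEnd (apex s) (suc (suc p)) (suc (suc q)) (suc (suc r)) x
  spoke-step s p next (x , y) (_ , y≡) (x≡0 , q≤y , y≤r) =
    suc (suc p) , cong₂ _,_ x≡0 y≡p , inj₂ refl ,
    Sum.map (cong onPath) (cong onPath)
      (height-between next (subst (_ ℚ.≤_) y≡p q≤y) (subst (ℚ._≤ _) y≡p y≤r))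
    where y≡p = spoke-at-path s x≡0 y≡

  step-step : ∀ {p p′ q q′} (next : suc (toℕ p) ≡ toℕ p′) (next′ : suc (toℕ q) ≡ toℕ q′) x → toℕ p ℕ.< toℕ q →
              Region (step {p} {p′} next) x → Region (step {q} {q′} next′) x →
              CommonEnd (suc (suc p)) (suc (suc p′)) (suc (suc q)) (suc (suc q′)) x
  step-step {p} {p′} {q} next next′ (x , y) p<q (x≡0 , _ , y≤p′) (_ , q≤y , _) =
    suc (suc q) , cong₂ _,_ x≡0 (ℚ.≤-antisym (ℚ.≤-trans y≤p′ (height-mono p′≤q)) q≤y) ,
    inj₂ (cong onPath (toℕ-injective (ℕ.≤-antisym (height-cancel-≤ (ℚ.≤-trans q≤y y≤p′)) p′≤q))) , inj₁ refl
    where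
    p′≤q : toℕ p′ ℕ.≤ toℕ q
    p′≤q = subst (ℕ._≤ toℕ q) next p<q

  regions-meet : ∀ {a b c d} (e : Oriented a b) (f : Oriented c d) → ¬ Same a b c d →
                 ∀ x → Region e x → Region f x → CommonEnd a b c d x
  regions-meet base base ¬same _ _ _ = ⊥-elim (¬same (inj₁ (refl , refl)))
  regions-meet base (spoke s p) _ x r r′ = base-spoke s p x r r′
  regions-meet (spoke s p) base _ x r r′ = swap-edges (base-spoke s p x r′ r)
  regions-meet base (step _) _ _ refl (_ , p≤0 , _) = ⊥-elim (height≰0 p≤0)
  regions-meet (step _) base _ _ (_ , p≤0 , _) refl = ⊥-elim (height≰0 p≤0)
  regions-meet (spoke left  p) (spoke right q) _ x r r′ = left-right p q x r r′
  regions-meet (spoke right p) (spoke left  q) _ x r r′ = swap-edges (left-right q p x r′ r)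
  regions-meet (spoke left  p) (spoke left  q) ¬same x r r′ =
    spoke-spoke left p q x (λ { refl → ¬same (inj₁ (refl , refl)) }) r r′
  regions-meet (spoke right p) (spoke right q) ¬same x r r′ =
    spoke-spoke right p q x (λ { refl → ¬same (inj₁ (refl , refl)) }) r r′
  regions-meet (spoke s p) (step next) _ x r r′ = spoke-step s p next x r r′
  regions-meet (step next) (spoke s p) _ x r r′ = swap-edges (spoke-step s p next x r′ r)
  regions-meet (step {p} next) (step {q} next′) ¬same x r r′ with ℕ.<-cmp (toℕ p) (toℕ q)
  ... | tri< p<q _ _ = step-step next next′ x p<q r r′
  ... | tri> _ _ q<p = swap-edges (step-step next′ next x q<p r′ r)
  -- Steps with the same lower end have the same upper end, so they are one edge.
  ... | tri≈ _ p≡q _ = ⊥-elim (¬same (inj₁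
    ( cong onPath (toℕ-injective p≡q)
    , cong onPath (toℕ-injective (trans (≡-sym next) (trans (cong suc p≡q) next′))))))

  drawing : StraightLineDrawing G
  drawing = record
    { pos             = pos
    ; pos-injective   = pos-injective
    ; vertex-off-edge = off-edge
    ; edges-disjoint  = disjoint
    }
    where
    off-edge : ∀ v a b → Edge G a b → OnSegment (pos v) (pos a) (pos b) → v ≡ a ⊎ v ≡ b
    off-edge v a b ab on with orient a b ab
    ... | inj₁ e = vertex-in-region e v (segment⊆region e (pos v) on)
    ... | inj₂ e = Sum.swap (vertex-in-region e v (segment⊆region e (pos v) (OnSegment-sym (pos a) (pos b) on)))

    disjoint : ∀ a b c d → Edge G a b → Edge G c d → ¬ Same a b c d →
               ∀ x → OnSegment x (pos a) (pos b) → OnSegment x (pos c) (pos d) → CommonEnd a b c d x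
    disjoint a b c d ab cd ¬same x on on′ with orient a b ab | orient c d cd
    ... | inj₁ e | inj₁ f = regions-meet e f ¬same x (segment⊆region e x on) (segment⊆region f x on′)
    ... | inj₁ e | inj₂ f =
      let w , eq , w∈ab , w∈cd = regions-meet e f (¬same ∘ Sum.swap) x (segment⊆region e x on)
                                   (segment⊆region f x (OnSegment-sym (pos c) (pos d) on′))
      in w , eq , w∈ab , Sum.swap w∈cd
    ... | inj₂ e | inj₁ f =
      let w , eq , w∈ab , w∈cd = regions-meet e f (¬same ∘ Sum.map swap swap ∘ Sum.swap) x
                                   (segment⊆region e x (OnSegment-sym (pos a) (pos b) on)) (segment⊆region f x on′)
      in w , eq , Sum.swap w∈ab , w∈cd
    ... | inj₂ e | inj₂ f =
      let w , eq , w∈ab , w∈cd = regions-meet e f (¬same ∘ Sum.map swap swap) x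
                                   (segment⊆region e x (OnSegment-sym (pos a) (pos b) on))
                                   (segment⊆region f x (OnSegment-sym (pos c) (pos d) on′))
      in w , eq , Sum.swap w∈ab , Sum.swap w∈cd

theorem3p11 : ∃[ G ] (Planar G × HG≥ G 22)
theorem3p11 =
  let N , winning = K₂∨P-winning zero path₁₀
  in K₂∨P N , drawing , 22 , ℕ.≤-refl , winning
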